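{- For all positive integers $n$ and $k$, the number of permutations in $s^{ -1}(\mathrm{Av}_n(231,312))$ that have exactly $k-1$ descents is $\mathrm{BoNa}(n,k)$.
   Context: A binary plane tree is a rooted plane tree on unlabeled vertices in which every non-leaf vertex has one or two children, and every child is a left child or a right child, even if it is the only child of its parent. A 0-1-tree is a binary plane tree in which every vertex that has two children is labeled 0 or 1 (no other vertex is labeled). A right edge is an edge connecting a vertex to its right child. For $n\ge 1$, the Boolean-Narayana number $\mathrm{BoNa}(n,k)$ is the number of 0-1-trees on $n$ vertices that have exactly $k-1$ right edges. The stack sorting operation $s$ is defined recursively on finite strings of distinct positive integers (permutations and their substrings): $s$ of the empty string is empty, $s$ of a one-element string is itself, and if $p=LmR$ where $m$ is the maximum entry of $p$, $L$ is the (possibly empty) substring of entries to the left of $m$ and $R$ the (possibly empty) substring of entries to the right of $m$, then $s(p)=s(L)\,s(R)\,m$. A permutation $p=p_1p_2\cdots p_n$ contains the pattern $q=q_1\cdots q_k$ if there are indices $i_1<\cdots<i_k$ such that $p_{i_a}<p_{i_b}$ if and only if $q_a<q_b$; otherwise $p$ avoids $q$. $\mathrm{Av}_n(q,q')$ is the set of permutations of length $n$ that avoid both $q$ and $q'$, and $s^{ -1}(\mathrm{Av}_n(q,q'))$ is the set of permutations $p$ of length $n$ such that $s(p)\in \mathrm{Av}_n(q,q')$. An index $i$ with $1\le i\le n-1$ is a descent of $p$ if $p_i>p_{i+1}$. -}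

module Defs where

open import Data.Bool using (if_then_else_)
open import Data.Fin as Fin using (Fin)
open import Data.List using (List; []; _∷_; [_]; _++_; length; map; filter; lookup; allFin; applyUpTo; cartesianProduct; cartesianProductWith)
open import Data.List.Membership.Propositional using (_∈_)
open import Data.List.Membership.Propositional.Properties
open import Data.List.Properties using (length-++)
open import Data.List.Relation.Binary.Disjoint.Propositional using (Disjoint)
open import Data.List.Relation.Binary.Permutation.Propositional using (_↭_)
open import Data.List.Relation.Unary.All using (All; []; _∷_)
open import Data.List.Relation.Unary.AllPairs using ([]; _∷_)
open import Data.List.Relation.Unary.Any using (here; there)
open import Data.List.Relation.Unary.Unique.Propositional using (Unique)
import Data.List.Relation.Unary.Unique.Propositional.Properties as Unique
open import Data.Nat using (ℕ; zero; suc; _+_; _∸_; _≤_; _<_; _≟_; _<?_; s≤s)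
open import Data.Nat.Properties
open import Data.Product using (∃-syntax; Σ-syntax; _×_; _,_; proj₁; proj₂)
open import Data.Sum using (inj₁; inj₂)
open import Function.Bundles using (_⇔_; mk⇔)
open import Relation.Binary.PropositionalEquality using (_≡_; refl; sym; trans; cong; cong₂; subst)
open import Relation.Nullary using (¬_; yes; no; does; contradiction)
open import Relation.Nullary.Decidable using (_×-dec_)
open import Relation.Unary using (Decidable)

-- "The number of x : A with P x is m."  Counting elements x, not proofs of P x:
-- a predicate may have several proofs at the same x without affecting the count.
HasCardinality : {A : Set} → (A → Set) → ℕ → Set
HasCardinality P m = ∃[ xs ] Unique xs × (∀ x → x ∈ xs ⇔ P x) × length xs ≡ m

-- Only the constructor for a vertex with two children carries a label.
data 01-Tree : Set where
  leaf      : 01-Tree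
  onlyLeft  : 01-Tree → 01-Tree
  onlyRight : 01-Tree → 01-Tree
  both      : Fin 2 → 01-Tree → 01-Tree → 01-Tree

vertices : 01-Tree → ℕ
vertices leaf          = 1
vertices (onlyLeft l)  = 1 + vertices l
vertices (onlyRight r) = 1 + vertices r
vertices (both _ l r)  = 1 + (vertices l + vertices r)

rightEdges : 01-Tree → ℕ
rightEdges leaf          = 0
rightEdges (onlyLeft l)  = rightEdges l
rightEdges (onlyRight r) = 1 + rightEdges r
rightEdges (both _ l r)  = 1 + (rightEdges l + rightEdges r)

both′ : Fin 2 → 01-Tree × 01-Tree → 01-Tree
both′ a (l , r) = both a l r

-- All 0-1-trees in which every path from the root has at most d vertices.
treesOfDepth≤ : ℕ → List 01-Tree
treesOfDepth≤ zero    = []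
treesOfDepth≤ (suc d) =
  [ leaf ] ++ map onlyLeft ts ++ map onlyRight ts ++
  cartesianProductWith both′ (allFin 2) (cartesianProduct ts ts)
  where ts = treesOfDepth≤ d

BoNaTree : ℕ → ℕ → 01-Tree → Set
BoNaTree n k t = vertices t ≡ n × rightEdges t ≡ k ∸ 1

BoNaTree? : ∀ n k → Decidable (BoNaTree n k)
BoNaTree? n k t = (vertices t ≟ n) ×-dec (rightEdges t ≟ k ∸ 1)

-- A tree on n vertices has depth at most n, so the list below misses none of
-- them; BoNa-counts makes this precise.  Meaningful for n ≥ 1 and k ≥ 1.
BoNa : ℕ → ℕ → ℕ
BoNa n k = length (filter (BoNaTree? n k) (treesOfDepth≤ n))

treesOfDepth≤-unique : ∀ d → Unique (treesOfDepth≤ d)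
treesOfDepth≤-unique zero    = []
treesOfDepth≤-unique (suc d) =
  Unique.++⁺ ([] ∷ []) (Unique.++⁺ (Unique.map⁺ (λ { refl → refl }) u)
    (Unique.++⁺ (Unique.map⁺ (λ { refl → refl }) u)
      (Unique.cartesianProductWith⁺ both′ (λ { refl → refl , refl })
        (Unique.allFin⁺ 2) (Unique.cartesianProduct⁺ u u))
      right#both)
    left#rest) leaf#rest
  where
  ts = treesOfDepth≤ d
  u  = treesOfDepth≤-unique d
  bs = cartesianProductWith both′ (allFin 2) (cartesianProduct ts ts)

  right#both : Disjoint (map onlyRight ts) bs
  right#both (p , q)
    with ∈-map⁻ onlyRight p | ∈-cartesianProductWith⁻ both′ (allFin 2) (cartesianProduct ts ts) q
  ... | _ , _ , refl | _ , _ , _ , _ , ()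

  left#rest : Disjoint (map onlyLeft ts) (map onlyRight ts ++ bs)
  left#rest (p , q) with ∈-map⁻ onlyLeft p | ∈-++⁻ (map onlyRight ts) q
  ... | _ , _ , refl | inj₁ q′ with () ← proj₂ (proj₂ (∈-map⁻ onlyRight q′))
  ... | _ , _ , refl | inj₂ q′
    with () ← proj₂ (proj₂ (proj₂ (proj₂ (∈-cartesianProductWith⁻ both′ (allFin 2) (cartesianProduct ts ts) q′))))

  leaf#rest : Disjoint [ leaf ] (map onlyLeft ts ++ map onlyRight ts ++ bs)
  leaf#rest (here refl , q) with ∈-++⁻ (map onlyLeft ts) q
  ... | inj₁ q′ with () ← proj₂ (proj₂ (∈-map⁻ onlyLeft q′))
  ... | inj₂ q′ with ∈-++⁻ (map onlyRight ts) q′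
  ...   | inj₁ q″ with () ← proj₂ (proj₂ (∈-map⁻ onlyRight q″))
  ...   | inj₂ q″
    with () ← proj₂ (proj₂ (proj₂ (proj₂ (∈-cartesianProductWith⁻ both′ (allFin 2) (cartesianProduct ts ts) q″))))

treesOfDepth≤-complete : ∀ d t → vertices t ≤ d → t ∈ treesOfDepth≤ d
treesOfDepth≤-complete (suc d) leaf          _       = here refl
treesOfDepth≤-complete (suc d) (onlyLeft l)  (s≤s h) =
  there (∈-++⁺ˡ (∈-map⁺ onlyLeft (treesOfDepth≤-complete d l h)))
treesOfDepth≤-complete (suc d) (onlyRight r) (s≤s h) =
  there (∈-++⁺ʳ (map onlyLeft (treesOfDepth≤ d))
    (∈-++⁺ˡ (∈-map⁺ onlyRight (treesOfDepth≤-complete d r h))))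
treesOfDepth≤-complete (suc d) (both a l r)  (s≤s h) =
  there (∈-++⁺ʳ (map onlyLeft (treesOfDepth≤ d)) (∈-++⁺ʳ (map onlyRight (treesOfDepth≤ d))
    (∈-cartesianProductWith⁺ both′ (∈-allFin a) (∈-cartesianProduct⁺
      (treesOfDepth≤-complete d l (m+n≤o⇒m≤o (vertices l) h))
      (treesOfDepth≤-complete d r (m+n≤o⇒n≤o (vertices l) h))))))

BoNa-counts : ∀ n k → HasCardinality (BoNaTree n k) (BoNa n k)
BoNa-counts n k =
  filter (BoNaTree? n k) (treesOfDepth≤ n) ,
  Unique.filter⁺ (BoNaTree? n k) (treesOfDepth≤-unique n) ,
  (λ t → mk⇔
    (λ t∈ → proj₂ (∈-filter⁻ (BoNaTree? n k) {xs = treesOfDepth≤ n} t∈))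
    (λ p → ∈-filter⁺ (BoNaTree? n k) (treesOfDepth≤-complete n t (≤-reflexive (proj₁ p))) p)) ,
  refl

-- p is the one-line notation p₁ p₂ ⋯ pₙ of a permutation of 1, …, n.
IsPermutation : ℕ → List ℕ → Set
IsPermutation n p = p ↭ applyUpTo suc n

Contains : List ℕ → List ℕ → Set
Contains p q = Σ[ i ∈ (Fin (length q) → Fin (length p)) ]
  (∀ a b → a Fin.< b → i a Fin.< i b) ×
  (∀ a b → lookup p (i a) < lookup p (i b) ⇔ lookup q a < lookup q b)

Avoids : List ℕ → List ℕ → Set
Avoids p q = ¬ Contains p q

Av : ℕ → List ℕ → List ℕ → List ℕ → Set
Av n q q′ p = IsPermutation n p × Avoids p q × Avoids p q′

descents : List ℕ → ℕ
descents []           = 0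
descents (_ ∷ [])     = 0
descents (x ∷ y ∷ ys) = (if does (y <? x) then 1 else 0) + descents (y ∷ ys)

-- The decomposition x ∷ xs = L ++ m ∷ R at the maximum entry m.
splitAtMax : ℕ → List ℕ → List ℕ × ℕ × List ℕ
splitAtMax x []       = [] , x , []
splitAtMax x (y ∷ ys) with splitAtMax y ys
... | L , m , R with m <? x
...   | yes _ = [] , x , y ∷ ys
...   | no  _ = x ∷ L , m , R

-- The first argument only bounds the recursion depth; see stackSort-node.
stackSortWithin : ℕ → List ℕ → List ℕ
stackSortWithin _       []       = []
stackSortWithin zero    (_ ∷ _)  = []
stackSortWithin (suc f) (x ∷ xs) with splitAtMax x xs
... | L , m , R = stackSortWithin f L ++ stackSortWithin f R ++ [ m ]

stackSort : List ℕ → List ℕ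
stackSort p = stackSortWithin (length p) p

splitAtMax-length : ∀ x xs → let (L , _ , R) = splitAtMax x xs in
                    length L + length R ≡ length xs
splitAtMax-length x []       = refl
splitAtMax-length x (y ∷ ys) with splitAtMax y ys | splitAtMax-length y ys
... | L , m , R | eq with m <? x
...   | yes _ = refl
...   | no  _ = cong suc eq

stackSortWithin-irrelevant : ∀ f g p → length p ≤ f → length p ≤ g →
                             stackSortWithin f p ≡ stackSortWithin g p
stackSortWithin-irrelevant f       g       []       _       _       = refl
stackSortWithin-irrelevant (suc f) (suc g) (x ∷ xs) (s≤s hf) (s≤s hg)
  with splitAtMax x xs | splitAtMax-length x xs
... | L , m , R | eq = cong₂ (λ u v → u ++ v ++ [ m ])
  (stackSortWithin-irrelevant f g L (≤-trans L≤ hf) (≤-trans L≤ hg))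
  (stackSortWithin-irrelevant f g R (≤-trans R≤ hf) (≤-trans R≤ hg))
  where
  L≤ : length L ≤ length xs
  L≤ = ≤-trans (m≤m+n (length L) (length R)) (≤-reflexive eq)
  R≤ : length R ≤ length xs
  R≤ = ≤-trans (m≤n+m (length R) (length L)) (≤-reflexive eq)

splitAtMax-bound : ∀ {m} y ys → y < m → All (_< m) ys → proj₁ (proj₂ (splitAtMax y ys)) < m
splitAtMax-bound y []       h []       = h
splitAtMax-bound y (z ∷ zs) h (k ∷ ks) with splitAtMax z zs | splitAtMax-bound z zs k ks
... | L , w , R | w<m with w <? y
...   | yes _ = h
...   | no  _ = w<m

splitAtMax-head : ∀ m R → All (_< m) R → splitAtMax m R ≡ ([] , m , R)
splitAtMax-head m []       []       = refl
splitAtMax-head m (y ∷ ys) (h ∷ hs) with splitAtMax y ys | splitAtMax-bound y ys h hs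
... | L , w , R | w<m with w <? m
...   | yes _   = refl
...   | no  w≮m = contradiction w<m w≮m

splitAtMax-tail : ∀ x L m R → x < m → All (_< m) L → All (_< m) R →
                  splitAtMax x (L ++ m ∷ R) ≡ (x ∷ L , m , R)
splitAtMax-tail x []      m R x<m []       hR rewrite splitAtMax-head m R hR with m <? x
... | yes m<x = contradiction m<x (<-asym x<m)
... | no  _   = refl
splitAtMax-tail x (y ∷ L) m R x<m (h ∷ hL) hR rewrite splitAtMax-tail y L m R h hL hR with m <? x
... | yes m<x = contradiction m<x (<-asym x<m)
... | no  _   = refl

-- The defining recursion s(LmR) = s(L) s(R) m; together with
-- stackSort [] = [] it determines stackSort on lists of distinct entries.
stackSort-node : ∀ L m R → All (_< m) L → All (_< m) R →
                 stackSort (L ++ m ∷ R) ≡ stackSort L ++ stackSort R ++ [ m ]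
stackSort-node [] m R [] hR rewrite splitAtMax-head m R hR = refl
stackSort-node (x ∷ L) m R (h ∷ hL) hR rewrite splitAtMax-tail x L m R h hL hR =
  cong₂ (λ u v → u ++ v ++ [ m ])
    (stackSortWithin-irrelevant _ _ (x ∷ L)
      (subst (suc (length L) ≤_) (sym len) (s≤s (m≤m+n (length L) (length R)))) ≤-refl)
    (stackSortWithin-irrelevant _ _ R
      (subst (length R ≤_) (sym len) (m≤n⇒m≤1+n (m≤n+m (length R) (length L)))) ≤-refl)
  where
  len : length (L ++ m ∷ R) ≡ suc (length L + length R)
  len = trans (length-++ L) (+-suc (length L) (length R))

-- s⁻¹(X) among the permutations of length n, for a set X of permutations.
stackSort⁻¹ : ℕ → (List ℕ → Set) → List ℕ → Set
stackSort⁻¹ n X p = IsPermutation n p × X (stackSort p)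

{-# OPTIONS --safe #-}

-- Avoiding 231 and 312 means being layered.  Write p = L m R with m maximal.
-- Then s(p) = s(L) s(R) m is layered iff s(L) s(R) is; as s(L) ends in its
-- maximum a, this happens in exactly two ways when L and R are nonempty and
-- their patterns are given: either all of L lies below all of R, or a alone
-- lies above precisely the first layer of s(R) and the rest of L lies below R.
-- The label of the root of the decreasing binary tree of p records which.

module Submission where

open import Data.Bool using (if_then_else_)
open import Data.Empty using (⊥-elim)
open import Data.Fin as Fin using (Fin; zero; suc)
open import Data.List using (List; _∷_; []; [_]; _++_; length; lookup; map; applyUpTo; applyDownFrom)
open import Data.List.Membership.Propositional using (_∈_)
open import Data.List.Membership.Propositional.Properties using (∈-++⁺ˡ; ∈-++⁺ʳ; ∈-++⁻; ∈-∃++; ∈-lookup; ∈-map⁺; ∈-map⁻)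
open import Data.List.Properties using (∷-injectiveˡ; ∷-injectiveʳ; ++-assoc; ++-identityʳ; length-++; length-map; length-applyDownFrom; reverse-applyUpTo; tabulate-lookup)
open import Data.List.Relation.Binary.Permutation.Propositional using (_↭_; ↭-refl; ↭-reflexive; ↭-sym; ↭-trans; ↭-prep; ↭⇒↭ₛ; module PermutationReasoning)
import Data.List.Relation.Binary.Permutation.Propositional.Properties as Perm
import Data.List.Relation.Binary.Permutation.Setoid.Properties as PermSetoid
open import Data.List.Relation.Unary.All as All using (All; []; _∷_; all?)
import Data.List.Relation.Unary.All.Properties as All
open import Data.List.Relation.Unary.AllPairs as AllPairs using (AllPairs; []; _∷_)
import Data.List.Relation.Unary.AllPairs.Properties as AllPairs
open import Data.List.Relation.Unary.Any using (here; there)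
open import Data.List.Relation.Unary.Unique.Propositional using (Unique)
import Data.List.Relation.Unary.Unique.Propositional.Properties as Unique
open import Data.Nat using (ℕ; zero; suc; _+_; _≤_; _<_; _>_; _∸_; _<?_; z≤n; s≤s)
open import Data.Nat.Properties
open import Data.Product using (∃-syntax; _×_; _,_; proj₁; proj₂)
open import Data.Sum using (_⊎_; inj₁; inj₂)
open import Function.Base using (_∘_)
open import Function.Bundles using (_⇔_; mk⇔; Equivalence)
open import Relation.Binary.Definitions using (tri<; tri≈; tri>)
open import Relation.Binary.PropositionalEquality using (_≡_; _≢_; refl; sym; trans; cong; cong₂; subst; setoid; module ≡-Reasoning)
open import Relation.Nullary using (¬_; does; contradiction)
open import Relation.Nullary.Decidable using (dec-true; dec-false; from-yes; from-no)
open import Defs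

-- Label 1 makes sense only if the tree alone determines how many values of R lie below a. That
-- number is the length of the first layer of s(R), so it is computed by recursion on the tree
-- (`firstLayer`) and proved correct together with layeredness (`Fill-Layered`). There are no
-- further cases: in a layered word the entries after a that are smaller than a follow it
-- immediately in decreasing order, and all later entries exceed a. Within s(R) they are therefore
-- either nothing or exactly the first layer. No other entry x of s(L) exceeds one of them, z, since
-- x a z would form 231. Under label 1 the values given to a subtree need not form an interval, so
-- `Fill` works with an arbitrary decreasing list of values, and 1, ..., n enters only at the end.
-- Descents match right edges because the maximum m is never the bottom of a descent, and it is the
-- top of one exactly when R is nonempty.

-- Lists: cross comparisons, cutting by length, distinctness

Desc : List ℕ → Set
Desc = AllPairs _>_

infix 4 _≪_
_≪_ : List ℕ → List ℕ → Set
A ≪ B = ∀ {x y} → x ∈ A → y ∈ B → x < y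

AllPairs-++⁻ : ∀ {R : ℕ → ℕ → Set} A {B} → AllPairs R (A ++ B) →
               AllPairs R A × AllPairs R B × (∀ {x y} → x ∈ A → y ∈ B → R x y)
AllPairs-++⁻ []      h        = [] , h , λ ()
AllPairs-++⁻ (x ∷ A) (hx ∷ h) with AllPairs-++⁻ A h
... | hA , hB , cross = All.++⁻ˡ A hx ∷ hA , hB , λ
  { (here refl) y∈ → All.lookup (All.++⁻ʳ A hx) y∈
  ; (there x∈)  y∈ → cross x∈ y∈ }

AllPairs-++⁺ : ∀ {R : ℕ → ℕ → Set} {A B} → AllPairs R A → AllPairs R B →
               (∀ {x y} → x ∈ A → y ∈ B → R x y) → AllPairs R (A ++ B)
AllPairs-++⁺ hA hB cross =
  AllPairs.++⁺ hA hB (All.tabulate λ x∈ → All.tabulate λ y∈ → cross x∈ y∈)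

++-injective : ∀ {A B A′ B′ : List ℕ} → length A ≡ length A′ → A ++ B ≡ A′ ++ B′ →
               A ≡ A′ × B ≡ B′
++-injective {[]}    {_} {[]}     _   eq = refl , eq
++-injective {x ∷ A} {_} {y ∷ A′} len eq
  with ++-injective {A} (suc-injective len) (∷-injectiveʳ eq)
... | eqA , eqB = cong₂ _∷_ (∷-injectiveˡ eq) eqA , eqB

++-injective-suffix : ∀ {A B A′ B′ : List ℕ} → length B ≡ length B′ → A ++ B ≡ A′ ++ B′ →
                      A ≡ A′ × B ≡ B′
++-injective-suffix {A} {B} {A′} {B′} len eq = ++-injective (+-cancelʳ-≡ _ _ _ lengths) eq
  where
  open ≡-Reasoning
  lengths : length A + length B ≡ length A′ + length B
  lengths = begin
    length A + length B    ≡⟨ length-++ A ⟨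
    length (A ++ B)        ≡⟨ cong length eq ⟩
    length (A′ ++ B′)      ≡⟨ length-++ A′ ⟩
    length A′ + length B′  ≡⟨ cong (length A′ +_) len ⟨
    length A′ + length B   ∎

splitLength : ∀ m {n} (X : List ℕ) → length X ≡ m + n →
              ∃[ A ] ∃[ B ] X ≡ A ++ B × length A ≡ m × length B ≡ n
splitLength zero    X       len = [] , X , refl , refl , len
splitLength (suc m) (x ∷ X) len with splitLength m X (suc-injective len)
... | A , B , refl , lA , lB = x ∷ A , B , refl , cong suc lA , lB

Unique-resp-↭ : ∀ {p q : List ℕ} → p ↭ q → Unique p → Unique q
Unique-resp-↭ p↭q = PermSetoid.Unique-resp-↭ (setoid ℕ) (↭⇒↭ₛ p↭q)

Desc⇒Unique : ∀ {V} → Desc V → Unique V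
Desc⇒Unique = AllPairs.map >⇒≢

All-resp-↭ : ∀ {P : ℕ → Set} {A B} → A ↭ B → All P A → All P B
All-resp-↭ = Perm.All-resp-↭

-- Decreasing lists

max-unique : ∀ {a b A B} → a ∷ A ↭ b ∷ B → All (_< a) A → All (_< b) B → a ≡ b × A ↭ B
max-unique {a} {b} p hA hB with Perm.∈-resp-↭ p (here refl) | Perm.∈-resp-↭ (↭-sym p) (here refl)
... | here refl | _         = refl , Perm.drop-∷ p
... | there _   | here refl = refl , Perm.drop-∷ p
... | there a∈B | there b∈A = contradiction (All.lookup hA b∈A) (<-asym (All.lookup hB a∈B))

-- The head of a decreasing list is its maximum, so it belongs to `hi` as long as `hi` is nonempty;
-- remove it there and recurse. This turns a description of values up to order into a cut of the
-- value list.
Desc-split : ∀ V hi lo → Desc V → V ↭ hi ++ lo → lo ≪ hi →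
             ∃[ A ] ∃[ B ] V ≡ A ++ B × A ↭ hi × B ↭ lo
Desc-split V       []       lo dV         p lo≪hi = [] , V , refl , ↭-refl , p
Desc-split []      (h ∷ hi) lo dV         p lo≪hi = contradiction (↭-sym p) Perm.¬x∷xs↭[]
Desc-split (m ∷ V) (h ∷ hi) lo (m>V ∷ dV) p lo≪hi
  with ∈-++⁻ (h ∷ hi) (Perm.∈-resp-↭ p (here refl))
-- A maximum in `lo` would lie below `h`, which itself occurs in `m ∷ V`.
... | inj₂ m∈lo with Perm.∈-resp-↭ (↭-sym p) (here refl)
...   | here refl = contradiction (lo≪hi m∈lo (here refl)) (<-irrefl refl)
...   | there h∈V = contradiction (lo≪hi m∈lo (here refl)) (<-asym (All.lookup m>V h∈V))
Desc-split (m ∷ V) hi@(_ ∷ _) lo (m>V ∷ dV) p lo≪hi | inj₁ m∈hi with ∈-∃++ m∈hi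
... | H , K , hi≡ with Desc-split V (H ++ K) lo dV V↭ lo≪HK
  where
  p′ : m ∷ V ↭ H ++ m ∷ (K ++ lo)
  p′ = ↭-trans p (↭-reflexive (trans (cong (_++ lo) hi≡) (++-assoc H (m ∷ K) lo)))
  V↭ : V ↭ (H ++ K) ++ lo
  V↭ = ↭-trans (Perm.drop-mid [] H p′) (↭-reflexive (sym (++-assoc H K lo)))
  lo≪HK : lo ≪ H ++ K
  lo≪HK x∈ y∈ = lo≪hi x∈ (subst (_ ∈_) (sym hi≡)
    (Perm.∈-resp-↭ (↭-sym (Perm.shift m H K)) (there y∈)))
... | A , B , refl , A↭ , B↭ =
  m ∷ A , B , refl ,
  ↭-trans (↭-prep m A↭) (↭-trans (↭-sym (Perm.shift m H K)) (↭-reflexive (sym hi≡))) , B↭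

-- Layered words

-- For distinct entries with `z < x`, a failure of `z < y` is an occurrence of 312 and a failure of
-- `y < x` one of 231.
Between : ℕ → ℕ → ℕ → Set
Between x y z = z < x → z < y × y < x

-- For distinct entries this says that x y z never forms 231 or 312, whence
-- the word is an increasing sequence of decreasing blocks (its layers).
data Layered : List ℕ → Set where
  []  : Layered []
  _∷_ : ∀ {x xs} → AllPairs (Between x) xs → Layered xs → Layered (x ∷ xs)

-- The condition is vacuous when the later entry is in `U`; when it is in `D`, the earlier one is
-- too, and `D` decreases below `a`.
Between-++ : ∀ {a D U} → Desc D → All (_< a) D → All (a <_) U → AllPairs (Between a) (D ++ U)
Between-++ (d>D ∷ dD) (d<a ∷ D<a) a<U =
  All.++⁺ (All.map (λ z<d _ → z<d , d<a) d>D)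
          (All.map (λ a<z z<a → contradiction z<a (<-asym a<z)) a<U)
  ∷ Between-++ dD D<a a<U
Between-++ [] [] []          = []
Between-++ [] [] (_ ∷ a<U)   =
  All.map (λ a<z z<a → contradiction z<a (<-asym a<z)) a<U ∷ Between-++ [] [] a<U

Layered-++⁺ : ∀ {A B} → A ≪ B → Layered A → Layered B → Layered (A ++ B)
Layered-++⁺         A≪B []       hB = hB
Layered-++⁺ {x ∷ A} A≪B (h ∷ hA) hB =
  AllPairs-++⁺ h (Between-++ [] [] (All.tabulate (A≪B (here refl))))
    (λ _ z∈B z<x → contradiction z<x (<-asym (A≪B (here refl) z∈B)))
  ∷ Layered-++⁺ (A≪B ∘ there) hA hB

Layered-++⁻ : ∀ A {B} → Layered (A ++ B) → Layered A × Layered B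
Layered-++⁻ []      h       = [] , h
Layered-++⁻ (x ∷ A) (p ∷ h) with Layered-++⁻ A h
... | hA , hB = proj₁ (AllPairs-++⁻ A p) ∷ hA , hB

Layered⇒Between : ∀ A {a B x y} → Layered (A ++ a ∷ B) → x ∈ A → y ∈ B → Between x a y
Layered⇒Between (_ ∷ A) (p ∷ _) (here refl) y∈ with AllPairs-++⁻ A p
... | _ , a∷B , _ = All.lookup (AllPairs.head a∷B) y∈
Layered⇒Between (_ ∷ A) (_ ∷ h) (there x∈)  y∈ = Layered⇒Between A h x∈ y∈

-- Once some `y` exceeds `a`, so does every later `z`: `z < a` would force `y < a`. Hence the
-- entries below `a` form a prefix, and `Between` makes it decrease.
Between⇒split : ∀ {a} w → AllPairs (Between a) w → All (a ≢_) w →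
                ∃[ D ] ∃[ U ] w ≡ D ++ U × Desc D × All (_< a) D × All (a <_) U
Between⇒split []      _       _         = [] , [] , refl , [] , [] , []
Between⇒split {a} (y ∷ w) (p ∷ h) (a≢y ∷ a≢) with <-cmp a y
... | tri≈ _ a≡y _ = contradiction a≡y a≢y
... | tri< a<y _ _ = [] , y ∷ w , refl , [] , [] , a<y ∷ All.zipWith above (p , a≢)
  where
  above : ∀ {z} → Between a y z × a ≢ z → a < z
  above {z} (b , a≢z) with <-cmp a z
  ... | tri< a<z _ _ = a<z
  ... | tri≈ _ a≡z _ = contradiction a≡z a≢z
  ... | tri> _ _ z<a = contradiction (proj₂ (b z<a)) (<-asym a<y)
... | tri> _ _ y<a with Between⇒split w h a≢
...   | D , U , refl , dD , D<a , a<U =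
  y ∷ D , U , refl , All.zipWith (λ (b , z<a) → proj₁ (b z<a)) (All.++⁻ˡ D p , D<a) ∷ dD ,
  y<a ∷ D<a , a<U

-- The length of the first layer

run : List ℕ → ℕ
run []           = 0
run (x ∷ [])     = 1
run (x ∷ y ∷ ys) = if does (y <? x) then suc (run (y ∷ ys)) else 1

run-∷ : ∀ {x y} ys → y < x → run (x ∷ y ∷ ys) ≡ suc (run (y ∷ ys))
run-∷ {x} {y} ys y<x rewrite dec-true (y <? x) y<x = refl

-- The junction of `A` and `B` is an ascent, which stops the run.
run-++ : ∀ {A B} → A ≢ [] → A ≪ B → run (A ++ B) ≡ run A
run-++ {[]}                A≢[] _   = contradiction refl A≢[]
run-++ {a ∷ []}    {[]}    _    _   = refl
run-++ {a ∷ []}    {b ∷ B} _    A≪B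
  rewrite dec-false (b <? a) (<-asym (A≪B (here refl) (here refl))) = refl
run-++ {a ∷ x ∷ A}         _    A≪B =
  cong (if does (x <? a) then_else 1) (cong suc (run-++ {x ∷ A} (λ ()) (A≪B ∘ there)))

run-Desc : ∀ {D} → Desc D → run D ≡ length D
run-Desc []                               = refl
run-Desc ([] ∷ [])                        = refl
run-Desc {_ ∷ _ ∷ D} ((y<x ∷ _) ∷ dD) = trans (run-∷ D y<x) (cong suc (run-Desc dD))

run-firstLayer : ∀ {w} → Layered w → Unique w →
                 ∃[ D ] ∃[ U ] w ≡ D ++ U × Desc D × D ≪ U × length D ≡ run w
run-firstLayer []           _         = [] , [] , refl , [] , (λ ()) , refl
run-firstLayer {x ∷ w} (p ∷ h) (x≢ ∷ _) with Between⇒split w p x≢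
... | D , U , refl , dD , D<x , x<U =
  x ∷ D , U , refl , dxD , xD≪U , sym (trans (run-++ {x ∷ D} (λ ()) xD≪U) (run-Desc dxD))
  where
  dxD : Desc (x ∷ D)
  dxD = D<x ∷ dD
  xD≪U : x ∷ D ≪ U
  xD≪U (here refl) u∈ = All.lookup x<U u∈
  xD≪U (there d∈)  u∈ = <-trans (All.lookup D<x d∈) (All.lookup x<U u∈)

≪-straddle : ∀ {α a D U} → All (_< a) α → α ≪ D → All (a <_) U → α ≪ a ∷ D ++ U
≪-straddle         α<a α≪D a<U y∈ (here refl) = All.lookup α<a y∈
≪-straddle {D = D} α<a α≪D a<U y∈ (there z∈) with ∈-++⁻ D z∈
... | inj₁ z∈D = α≪D y∈ z∈D
... | inj₂ z∈U = <-trans (All.lookup α<a y∈) (All.lookup a<U z∈U)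

-- Everything after `α` lies above it, so on both sides the run ends within `α`.
run-straddle : ∀ {α a D U} → All (_< a) α → α ≪ D → All (a <_) U → α ≢ [] →
               run ((α ++ [ a ]) ++ D ++ U) ≡ run (α ++ [ a ])
run-straddle {α} {a} {D} {U} α<a α≪D a<U α≢[] = begin
  run ((α ++ [ a ]) ++ D ++ U)  ≡⟨ cong run (++-assoc α [ a ] (D ++ U)) ⟩
  run (α ++ a ∷ D ++ U)         ≡⟨ run-++ α≢[] (≪-straddle α<a α≪D a<U) ⟩
  run α                         ≡⟨ run-++ α≢[] (λ { y∈ (here refl) → All.lookup α<a y∈ }) ⟨
  run (α ++ [ a ])              ∎
  where open ≡-Reasoning

-- `α` lies below all that follows and splits off; then `a` only joins the layer `D` at its front.
Layered-straddle : ∀ {α a D U} → All (_< a) α → α ≪ D → Desc D → All (_< a) D → All (a <_) U →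
                   Layered (α ++ [ a ]) → Layered (D ++ U) → Layered ((α ++ [ a ]) ++ D ++ U)
Layered-straddle {α} {a} {D} {U} α<a α≪D dD D<a a<U hα hDU =
  subst Layered (sym (++-assoc α [ a ] (D ++ U)))
    (Layered-++⁺ (≪-straddle α<a α≪D a<U) (proj₁ (Layered-++⁻ α hα)) (Between-++ dD D<a a<U ∷ hDU))

-- The decomposition of a word at its maxima

-- The decreasing binary tree of a word, used as an induction principle: recursion on it follows
-- s(LmR) structurally, without a depth bound.
data MaxTree : List ℕ → Set where
  nil  : MaxTree []
  node : ∀ {L m R} → MaxTree L → MaxTree R → All (_< m) L → All (_< m) R → MaxTree (L ++ m ∷ R)

-- A new first entry below the root joins the left subtree; one above the root becomes the root,
-- with the whole old word on its right.
MaxTree-∷ : ∀ {x p} → All (x ≢_) p → MaxTree p → MaxTree (x ∷ p)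
MaxTree-∷ _  nil = node nil nil [] []
MaxTree-∷ {x} x≢ (node {L} {m} {R} l r L<m R<m) with <-cmp x m
... | tri< x<m _ _ = node (MaxTree-∷ (All.++⁻ˡ L x≢) l) r (x<m ∷ L<m) R<m
... | tri≈ _ x≡m _ = contradiction x≡m (All.head (All.++⁻ʳ L x≢))
... | tri> _ _ m<x = node nil (node l r L<m R<m) []
  (All.++⁺ (All.map (λ y<m → <-trans y<m m<x) L<m) (m<x ∷ All.map (λ y<m → <-trans y<m m<x) R<m))

maxTree : ∀ {p} → Unique p → MaxTree p
maxTree []       = nil
maxTree (x≢ ∷ u) = MaxTree-∷ x≢ (maxTree u)

++-∷-≢[] : ∀ (L : List ℕ) {m R} → L ++ m ∷ R ≢ []
++-∷-≢[] []      ()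
++-∷-≢[] (_ ∷ L) ()

stackSort-↭ : ∀ {p} → MaxTree p → stackSort p ↭ p
stackSort-↭ nil = ↭-refl
stackSort-↭ (node {L} {m} {R} l r L<m R<m) = begin
  stackSort (L ++ m ∷ R)                ≡⟨ stackSort-node L m R L<m R<m ⟩
  stackSort L ++ stackSort R ++ [ m ]   ↭⟨ Perm.++⁺ (stackSort-↭ l) (Perm.++⁺ʳ [ m ] (stackSort-↭ r)) ⟩
  L ++ R ++ [ m ]                       ↭⟨ Perm.++⁺ˡ L (Perm.++-comm R [ m ]) ⟩
  L ++ m ∷ R                            ∎
  where open PermutationReasoning

stackSort-∷ʳ : ∀ {p} → MaxTree p → p ≢ [] → ∃[ α ] ∃[ a ] stackSort p ≡ α ++ [ a ] × All (_< a) α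
stackSort-∷ʳ nil p≢[] = contradiction refl p≢[]
stackSort-∷ʳ (node {L} {m} {R} l r L<m R<m) _ =
  stackSort L ++ stackSort R , m ,
  trans (stackSort-node L m R L<m R<m) (sym (++-assoc (stackSort L) (stackSort R) [ m ])) ,
  All.++⁺ (All-resp-↭ (↭-sym (stackSort-↭ l)) L<m) (All-resp-↭ (↭-sym (stackSort-↭ r)) R<m)

descents-++ : ∀ {m L} R → All (_< m) L → descents (L ++ m ∷ R) ≡ descents L + descents (m ∷ R)
descents-++         R []          = refl
descents-++ {m} {x ∷ []} R (x<m ∷ []) rewrite dec-false (m <? x) (<-asym x<m) = refl
descents-++ {m} {x ∷ y ∷ L} R (_ ∷ L<m) =
  trans (cong (d +_) (descents-++ R L<m)) (sym (+-assoc d (descents (y ∷ L)) (descents (m ∷ R))))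
  where
  d : ℕ
  d = if does (y <? x) then 1 else 0

descents-node : ∀ {m L R} → All (_< m) L → All (_< m) R → R ≢ [] →
                descents (L ++ m ∷ R) ≡ suc (descents L + descents R)
descents-node {R = []}            _   _         R≢[] = contradiction refl R≢[]
descents-node {m} {L} {R = x ∷ R} L<m (x<m ∷ _) _    = begin
  descents (L ++ m ∷ x ∷ R)               ≡⟨ descents-++ (x ∷ R) L<m ⟩
  descents L + descents (m ∷ x ∷ R)       ≡⟨ cong (λ b → descents L + ((if b then 1 else 0) + descents (x ∷ R))) (dec-true (x <? m) x<m) ⟩
  descents L + suc (descents (x ∷ R))     ≡⟨ +-suc (descents L) _ ⟩
  suc (descents L + descents (x ∷ R))     ∎
  where open ≡-Reasoning

-- Trees as permutations

-- The length of the first layer of s(p) for the word p of the tree. Normally s(L) decides it; but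
-- under label 1 with L a single entry, that entry heads the first layer of s(R) and lengthens it by
-- one.
firstLayer : 01-Tree → ℕ
firstLayer leaf                    = 1
firstLayer (onlyLeft l)            = firstLayer l
firstLayer (onlyRight r)           = firstLayer r
firstLayer (both zero l r)         = firstLayer l
firstLayer (both (suc _) leaf r)   = suc (firstLayer r)
firstLayer (both (suc _) l r)      = firstLayer l

-- Fill t V p: p is the permutation of the decreasing list V that t encodes.
-- Label 0 puts all values of L below those of R; label 1 moves the maximum a
-- of L up to just above the first layer D of s(R).
data Fill : 01-Tree → List ℕ → List ℕ → Set where
  leaf      : ∀ {m} → Fill leaf [ m ] [ m ]
  onlyLeft  : ∀ {l m V L} → Fill l V L → Fill (onlyLeft l) (m ∷ V) (L ++ [ m ])
  onlyRight : ∀ {r m W R} → Fill r W R → Fill (onlyRight r) (m ∷ W) (m ∷ R)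
  apart     : ∀ {l r m V W L R} → Fill l V L → Fill r W R →
              Fill (both zero l r) (m ∷ W ++ V) (L ++ m ∷ R)
  straddle  : ∀ {l r m a V U D L R} → Fill l (a ∷ V) L → Fill r (U ++ D) R →
              length D ≡ firstLayer r →
              Fill (both (suc zero) l r) (m ∷ U ++ a ∷ D ++ V) (L ++ m ∷ R)

Fill-↭ : ∀ {t V p} → Fill t V p → p ↭ V
Fill-↭ leaf = ↭-refl
Fill-↭ (onlyLeft {m = m} {L = L} fl) = ↭-trans (Perm.++-comm L [ m ]) (↭-prep m (Fill-↭ fl))
Fill-↭ (onlyRight {m = m} fr) = ↭-prep m (Fill-↭ fr)
Fill-↭ (apart {m = m} {V} {W} {L} {R} fl fr) = begin
  L ++ m ∷ R    ↭⟨ Perm.shift m L R ⟩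
  m ∷ L ++ R    ↭⟨ ↭-prep m (Perm.++-comm L R) ⟩
  m ∷ R ++ L    ↭⟨ ↭-prep m (Perm.++⁺ (Fill-↭ fr) (Fill-↭ fl)) ⟩
  m ∷ W ++ V    ∎
  where open PermutationReasoning
Fill-↭ (straddle {m = m} {a} {V} {U} {D} {L} {R} fl fr _) = begin
  L ++ m ∷ R                  ↭⟨ Perm.shift m L R ⟩
  m ∷ L ++ R                  ↭⟨ ↭-prep m (Perm.++-comm L R) ⟩
  m ∷ R ++ L                  ↭⟨ ↭-prep m (Perm.++⁺ (Fill-↭ fr) (Fill-↭ fl)) ⟩
  m ∷ (U ++ D) ++ a ∷ V       ≡⟨ cong (m ∷_) (++-assoc U D (a ∷ V)) ⟩
  m ∷ U ++ D ++ a ∷ V         ↭⟨ ↭-prep m (Perm.++⁺ˡ U (Perm.shift a D V)) ⟩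
  m ∷ U ++ a ∷ D ++ V         ∎
  where open PermutationReasoning

Fill-≢[] : ∀ {t V p} → Fill t V p → p ≢ []
Fill-≢[] leaf                        = λ ()
Fill-≢[] (onlyLeft {L = L} _)        = ++-∷-≢[] L
Fill-≢[] (onlyRight _)               = λ ()
Fill-≢[] (apart {L = L} _ _)         = ++-∷-≢[] L
Fill-≢[] (straddle {L = L} _ _ _)    = ++-∷-≢[] L

length-straddle : ∀ U {a : ℕ} D {V} →
                  length (U ++ a ∷ D ++ V) ≡ length (a ∷ V) + length (U ++ D)
length-straddle U {a} D {V} = begin
  length (U ++ a ∷ D ++ V)           ≡⟨ Perm.↭-length (Perm.++⁺ˡ U (Perm.shift a D V)) ⟨
  length (U ++ D ++ a ∷ V)           ≡⟨ cong length (++-assoc U D (a ∷ V)) ⟨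
  length ((U ++ D) ++ a ∷ V)         ≡⟨ length-++ (U ++ D) ⟩
  length (U ++ D) + length (a ∷ V)   ≡⟨ +-comm (length (U ++ D)) _ ⟩
  length (a ∷ V) + length (U ++ D)   ∎
  where open ≡-Reasoning

Fill-length : ∀ {t V p} → Fill t V p → length V ≡ vertices t
Fill-length leaf           = refl
Fill-length (onlyLeft fl)  = cong suc (Fill-length fl)
Fill-length (onlyRight fr) = cong suc (Fill-length fr)
Fill-length (apart {V = V} {W} fl fr) = cong suc
  (trans (length-++ W) (trans (+-comm (length W) (length V))
    (cong₂ _+_ (Fill-length fl) (Fill-length fr))))
Fill-length (straddle {U = U} {D} fl fr _) = cong suc
  (trans (length-straddle U D) (cong₂ _+_ (Fill-length fl) (Fill-length fr)))

0<vertices : ∀ t → 0 < vertices t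
0<vertices leaf          = s≤s z≤n
0<vertices (onlyLeft _)  = s≤s z≤n
0<vertices (onlyRight _) = s≤s z≤n
0<vertices (both _ _ _)  = s≤s z≤n

-- This keeps the labels apart: with an empty `D`, `straddle` would produce the same words as
-- `apart`.
0<firstLayer : ∀ t → 0 < firstLayer t
0<firstLayer leaf                                 = s≤s z≤n
0<firstLayer (onlyLeft l)                         = 0<firstLayer l
0<firstLayer (onlyRight r)                        = 0<firstLayer r
0<firstLayer (both zero l r)                      = 0<firstLayer l
0<firstLayer (both (suc _) leaf r)                = s≤s z≤n
0<firstLayer (both (suc _) l@(onlyLeft _) r)      = 0<firstLayer l
0<firstLayer (both (suc _) l@(onlyRight _) r)     = 0<firstLayer l
0<firstLayer (both (suc _) l@(both _ _ _) r)      = 0<firstLayer l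

-- Makes the subtraction `vertices r ∸ firstLayer r`, the length of `U`, an exact one.
firstLayer≤vertices : ∀ t → firstLayer t ≤ vertices t
firstLayer≤vertices leaf          = ≤-refl
firstLayer≤vertices (onlyLeft l)  = m≤n⇒m≤1+n (firstLayer≤vertices l)
firstLayer≤vertices (onlyRight r) = m≤n⇒m≤1+n (firstLayer≤vertices r)
firstLayer≤vertices (both zero l r) =
  m≤n⇒m≤1+n (m≤n⇒m≤n+o (vertices r) (firstLayer≤vertices l))
firstLayer≤vertices (both (suc _) leaf r) = s≤s (m≤n⇒m≤1+n (firstLayer≤vertices r))
firstLayer≤vertices (both (suc _) l@(onlyLeft _) r) =
  m≤n⇒m≤1+n (m≤n⇒m≤n+o (vertices r) (firstLayer≤vertices l))
firstLayer≤vertices (both (suc _) l@(onlyRight _) r) =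
  m≤n⇒m≤1+n (m≤n⇒m≤n+o (vertices r) (firstLayer≤vertices l))
firstLayer≤vertices (both (suc _) l@(both _ _ _) r) =
  m≤n⇒m≤1+n (m≤n⇒m≤n+o (vertices r) (firstLayer≤vertices l))

Fill-total : ∀ t V → length V ≡ vertices t → ∃[ p ] Fill t V p
Fill-total leaf          (m ∷ [])     len = _ , leaf
Fill-total leaf          (_ ∷ _ ∷ _)  ()
Fill-total (onlyLeft l)  (m ∷ V)      len = _ , onlyLeft (proj₂ (Fill-total l V (suc-injective len)))
Fill-total (onlyRight r) (m ∷ W)      len = _ , onlyRight (proj₂ (Fill-total r W (suc-injective len)))
Fill-total (both zero l r) (m ∷ X) len
  with splitLength (vertices r) X (trans (suc-injective len) (+-comm (vertices l) (vertices r)))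
... | W , V , refl , lW , lV = _ , apart (proj₂ (Fill-total l V lV)) (proj₂ (Fill-total r W lW))
Fill-total (both (suc zero) l r) (m ∷ X) len with vertices l in vl | 0<vertices l
-- From the top down: the values of R above `a`, then `a`, then `firstLayer r` values for `D`, then
-- the `v` remaining values of L.
... | suc v | _ with splitLength (vertices r ∸ firstLayer r) X |X|
  where
  open ≡-Reasoning
  |X| : length X ≡ (vertices r ∸ firstLayer r) + suc (firstLayer r + v)
  |X| = begin
    length X                                                 ≡⟨ suc-injective len ⟩
    suc (v + vertices r)                                     ≡⟨ cong suc (+-comm v (vertices r)) ⟩
    suc (vertices r + v)                                     ≡⟨ cong (λ n → suc (n + v)) (m∸n+n≡m (firstLayer≤vertices r)) ⟨
    suc ((vertices r ∸ firstLayer r + firstLayer r) + v)     ≡⟨ cong suc (+-assoc (vertices r ∸ firstLayer r) _ v) ⟩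
    suc ((vertices r ∸ firstLayer r) + (firstLayer r + v))   ≡⟨ +-suc (vertices r ∸ firstLayer r) _ ⟨
    (vertices r ∸ firstLayer r) + suc (firstLayer r + v)     ∎
... | U , a ∷ Y , refl , lU , lY with splitLength (firstLayer r) Y (suc-injective lY)
...   | D , V , refl , lD , lV = _ , straddle
  (proj₂ (Fill-total l (a ∷ V) (trans (cong suc lV) (sym vl))))
  (proj₂ (Fill-total r (U ++ D)
    (trans (length-++ U) (trans (cong₂ _+_ lU lD) (m∸n+n≡m (firstLayer≤vertices r))))))
  lD

-- The tree fixes the lengths of all segments of the value list, so equal lists are cut alike. The
-- equality is a separate argument because the indices are concatenations, which do not unify.
Fill-functional : ∀ {t V V′ p p′} → Fill t V p → Fill t V′ p′ → V ≡ V′ → p ≡ p′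
Fill-functional leaf leaf refl = refl
Fill-functional (onlyLeft {m = m} f) (onlyLeft f′) eq =
  cong₂ (λ L m → L ++ [ m ]) (Fill-functional f f′ (∷-injectiveʳ eq)) (∷-injectiveˡ eq)
Fill-functional (onlyRight f) (onlyRight f′) eq =
  cong₂ _∷_ (∷-injectiveˡ eq) (Fill-functional f f′ (∷-injectiveʳ eq))
Fill-functional (apart {W = W} fl fr) (apart {W = W′} fl′ fr′) eq
  with ++-injective {W} {_} {W′} (trans (Fill-length fr) (sym (Fill-length fr′))) (∷-injectiveʳ eq)
... | eqW , eqV with Fill-functional fl fl′ eqV | Fill-functional fr fr′ eqW | ∷-injectiveˡ eq
...   | refl | refl | refl = refl
Fill-functional (straddle {a = a} {V} {U} {D} fl fr lD) (straddle {a = a′} {V′} {U′} {D′} fl′ fr′ lD′) eq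
  with ++-injective {U} {_} {U′} lU (∷-injectiveʳ eq)
  where
  open ≡-Reasoning
  lU : length U ≡ length U′
  lU = +-cancelʳ-≡ (length D) _ _ (begin
    length U + length D     ≡⟨ length-++ U ⟨
    length (U ++ D)         ≡⟨ trans (Fill-length fr) (sym (Fill-length fr′)) ⟩
    length (U′ ++ D′)       ≡⟨ length-++ U′ ⟩
    length U′ + length D′   ≡⟨ cong (length U′ +_) (trans lD′ (sym lD)) ⟩
    length U′ + length D    ∎)
... | refl , eqaDV with ++-injective {D} {_} {D′} (trans lD (sym lD′)) (∷-injectiveʳ eqaDV) | ∷-injectiveˡ eqaDV
...   | refl , refl | refl with Fill-functional fl fl′ refl | Fill-functional fr fr′ refl | ∷-injectiveˡ eq
...     | refl | refl | refl = refl

below : ∀ {m L X p} R → p ↭ m ∷ X → p ≡ L ++ m ∷ R → All (_< m) X → All (_< m) L × All (_< m) R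
below {m} {L} R p↭ refl X<m = All.++⁻ L (All-resp-↭ (↭-sym (Perm.drop-mid L [] p↭)) X<m)

-- Recovers the order V, D, a, U from bottom to top, and shows that both subtrees again receive
-- decreasing lists.
Desc-straddle⁻ : ∀ U {a} D {V} → Desc (U ++ a ∷ D ++ V) →
                 Desc (U ++ D) × Desc (a ∷ V) × All (_< a) D × All (a <_) U × V ≪ D
Desc-straddle⁻ U D d with AllPairs-++⁻ U d
... | dU , a>DV ∷ dDV , U>aDV with AllPairs-++⁻ D dDV
...   | dD , dV , D>V =
  AllPairs-++⁺ dU dD (λ u∈ d∈ → U>aDV u∈ (there (∈-++⁺ˡ d∈))) ,
  All.++⁻ʳ D a>DV ∷ dV , All.++⁻ˡ D a>DV , All.tabulate (λ u∈ → U>aDV u∈ (here refl)) ,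
  (λ v∈ d∈ → D>V d∈ v∈)

Fill-descents : ∀ {t V p} → Desc V → Fill t V p → descents p ≡ rightEdges t
Fill-descents d leaf = refl
Fill-descents (V<m ∷ dV) f@(onlyLeft {l} {m} {V} {L} fl) =
  trans (descents-++ [] (proj₁ (below {L = L} [] (Fill-↭ f) refl V<m)))
    (trans (+-identityʳ _) (Fill-descents dV fl))
Fill-descents (W<m ∷ dW) f@(onlyRight fr) =
  trans (descents-node [] (proj₂ (below {L = []} _ (Fill-↭ f) refl W<m)) (Fill-≢[] fr))
    (cong suc (Fill-descents dW fr))
Fill-descents (X<m ∷ dX) f@(apart {W = W} {L} {R} fl fr)
  with below {L = L} R (Fill-↭ f) refl X<m | AllPairs-++⁻ W dX
... | L<m , R<m | dW , dV , _ = trans (descents-node L<m R<m (Fill-≢[] fr))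
  (cong suc (cong₂ _+_ (Fill-descents dV fl) (Fill-descents dW fr)))
Fill-descents (X<m ∷ dX) f@(straddle {U = U} {D} {L} {R} fl fr _)
  with below {L = L} R (Fill-↭ f) refl X<m | Desc-straddle⁻ U D dX
... | L<m , R<m | dW , dV , _ = trans (descents-node L<m R<m (Fill-≢[] fr))
  (cong suc (cong₂ _+_ (Fill-descents dV fl) (Fill-descents dW fr)))

-- Recovering the tree

-- One inversion between `L` and `R` reveals label 1: there the maximum of `L` exceeds the nonempty
-- `D`.
label : List ℕ → List ℕ → Fin 2
label L R = if does (all? (λ x → all? (x <?_) R) L) then zero else suc zero

label-apart : ∀ {L R} → L ≪ R → label L R ≡ zero
label-apart {L} {R} L≪R
  rewrite dec-true (all? (λ x → all? (x <?_) R) L)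
                   (All.tabulate λ x∈ → All.tabulate λ y∈ → L≪R x∈ y∈) = refl

label-straddle : ∀ {L R x y} → x ∈ L → y ∈ R → y < x → label L R ≡ suc zero
label-straddle {L} {R} x∈ y∈ y<x
  rewrite dec-false (all? (λ x → all? (x <?_) R) L)
                    (λ h → <-asym y<x (All.lookup (All.lookup h x∈) y∈)) = refl

-- The first argument only bounds the recursion depth.
decode     : ℕ → List ℕ → 01-Tree
decodeNode : ℕ → List ℕ × ℕ × List ℕ → 01-Tree
decode (suc f) (x ∷ xs)             = decodeNode f (splitAtMax x xs)
decode _       _                    = leaf
decodeNode f ([]        , m , [])   = leaf
decodeNode f (L@(_ ∷ _) , m , [])   = onlyLeft (decode f L)
decodeNode f ([]        , m , R)    = onlyRight (decode f R)
decodeNode f (L         , m , R)    = both (label L R) (decode f L) (decode f R)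

decode-node : ∀ f {L m R} → All (_< m) L → All (_< m) R →
              decode (suc f) (L ++ m ∷ R) ≡ decodeNode f (L , m , R)
decode-node f {[]}        []          R<m = cong (decodeNode f) (splitAtMax-head _ _ R<m)
decode-node f {x ∷ L} {m} (x<m ∷ L<m) R<m = cong (decodeNode f) (splitAtMax-tail x L m _ x<m L<m R<m)

decodeNode-both : ∀ f {L m R} → L ≢ [] → R ≢ [] →
                  decodeNode f (L , m , R) ≡ both (label L R) (decode f L) (decode f R)
decodeNode-both f {[]}            L≢[] _    = contradiction refl L≢[]
decodeNode-both f {_ ∷ _} {_} {[]} _   R≢[] = contradiction refl R≢[]
decodeNode-both f {_ ∷ _} {_} {_ ∷ _} _ _   = refl

decodeNode-onlyLeft : ∀ f {L m} → L ≢ [] → decodeNode f (L , m , []) ≡ onlyLeft (decode f L)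
decodeNode-onlyLeft f {[]}    L≢[] = contradiction refl L≢[]
decodeNode-onlyLeft f {_ ∷ _} _    = refl

decodeNode-onlyRight : ∀ f {m R} → R ≢ [] → decodeNode f ([] , m , R) ≡ onlyRight (decode f R)
decodeNode-onlyRight f {_} {[]}    R≢[] = contradiction refl R≢[]
decodeNode-onlyRight f {_} {_ ∷ _} _    = refl

-- Decoding follows the maxima, which are the heads of the value lists. The bound on `vertices t`
-- passes to the subtrees, so recursion never stops early at the default `leaf`.
Fill-decode : ∀ {f t V p} → vertices t ≤ f → Desc V → Fill t V p → decode f p ≡ t
Fill-decode {suc f} _ _ leaf = refl
Fill-decode {suc f} (s≤s v≤) (V<m ∷ dV) F@(onlyLeft {L = L} fl)
  with L<m , _ ← below {L = L} [] (Fill-↭ F) refl V<m =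
  trans (decode-node f L<m [])
    (trans (decodeNode-onlyLeft f (Fill-≢[] fl)) (cong onlyLeft (Fill-decode v≤ dV fl)))
Fill-decode {suc f} (s≤s v≤) (W<m ∷ dW) F@(onlyRight {R = R} fr)
  with _ , R<m ← below {L = []} R (Fill-↭ F) refl W<m =
  trans (decode-node f {[]} [] R<m)
    (trans (decodeNode-onlyRight f (Fill-≢[] fr)) (cong onlyRight (Fill-decode v≤ dW fr)))
Fill-decode {suc f} (s≤s v≤) (X<m ∷ dX) F@(apart {l} {r} {V = V} {W} {L} {R} fl fr)
  with below {L = L} R (Fill-↭ F) refl X<m | AllPairs-++⁻ W dX
... | L<m , R<m | dW , dV , W>V =
  trans (decode-node f L<m R<m) (trans (decodeNode-both f (Fill-≢[] fl) (Fill-≢[] fr))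
    (trans (cong₂ (both _) (Fill-decode (m+n≤o⇒m≤o _ v≤) dV fl) (Fill-decode (m+n≤o⇒n≤o (vertices l) v≤) dW fr))
      (cong (λ b → both b l r) (label-apart
        (λ x∈ y∈ → W>V (Perm.∈-resp-↭ (Fill-↭ fr) y∈) (Perm.∈-resp-↭ (Fill-↭ fl) x∈))))))
Fill-decode {suc f} (s≤s v≤) (X<m ∷ dX) F@(straddle {r = r} {D = []} fl fr lD) =
  contradiction (0<firstLayer r) (λ 0<r → <-irrefl lD 0<r)
Fill-decode {suc f} (s≤s v≤) (X<m ∷ dX) F@(straddle {l} {r} {U = U} {D = D@(_ ∷ _)} {L} {R} fl fr lD)
  with below {L = L} R (Fill-↭ F) refl X<m | Desc-straddle⁻ U D dX
... | L<m , R<m | dW , dV , d<a ∷ _ , _ =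
  trans (decode-node f L<m R<m) (trans (decodeNode-both f (Fill-≢[] fl) (Fill-≢[] fr))
    (trans (cong₂ (both _) (Fill-decode (m+n≤o⇒m≤o _ v≤) dV fl) (Fill-decode (m+n≤o⇒n≤o (vertices l) v≤) dW fr))
      (cong (λ b → both b l r) (label-straddle
        (Perm.∈-resp-↭ (↭-sym (Fill-↭ fl)) (here refl))
        (Perm.∈-resp-↭ (↭-sym (Fill-↭ fr)) (∈-++⁺ʳ U (here refl))) d<a))))

-- Trees encode exactly the permutations with a layered image

-- The final `m` is a layer of its own, above a nonempty word, so it affects neither property.
Layered-node : ∀ {m L R} → MaxTree L → MaxTree R → All (_< m) L → All (_< m) R →
               stackSort L ++ stackSort R ≢ [] → Layered (stackSort L ++ stackSort R) →
               Layered (stackSort (L ++ m ∷ R)) ×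
               run (stackSort (L ++ m ∷ R)) ≡ run (stackSort L ++ stackSort R)
Layered-node {m} {L} {R} l r L<m R<m w≢[] h
  rewrite stackSort-node L m R L<m R<m | sym (++-assoc (stackSort L) (stackSort R) [ m ])
  with stackSort L ++ stackSort R
     | All.++⁺ (All-resp-↭ (↭-sym (stackSort-↭ l)) L<m) (All-resp-↭ (↭-sym (stackSort-↭ r)) R<m)
... | []    | _   = contradiction refl w≢[]
... | x ∷ w | w<m = Layered-++⁺ w≪m h ([] ∷ []) , run-++ {x ∷ w} (λ ()) w≪m
  where
  w≪m : x ∷ w ≪ [ m ]
  w≪m y∈ (here refl) = All.lookup w<m y∈

≢[]-↭ : ∀ {A B : List ℕ} → A ↭ B → B ≢ [] → A ≢ []
≢[]-↭ p B≢[] refl = B≢[] (Perm.↭-empty-inv (↭-sym p))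

++-≢[] : ∀ {A : List ℕ} B → A ≢ [] → A ++ B ≢ []
++-≢[] {[]}    B A≢[] = contradiction refl A≢[]
++-≢[] {_ ∷ _} B _    = λ ()

Fill-maxTree : ∀ {t V p} → Desc V → Fill t V p → MaxTree p
Fill-maxTree d f = maxTree (Unique-resp-↭ (↭-sym (Fill-↭ f)) (Desc⇒Unique d))

Fill-stackSort-↭ : ∀ {t V p} → Desc V → Fill t V p → stackSort p ↭ V
Fill-stackSort-↭ d f = ↭-trans (stackSort-↭ (Fill-maxTree d f)) (Fill-↭ f)

Fill-stackSort-∷ʳ : ∀ {t a V p} → Desc (a ∷ V) → Fill t (a ∷ V) p →
                    ∃[ α ] stackSort p ≡ α ++ [ a ] × α ↭ V
Fill-stackSort-∷ʳ d@(V<a ∷ _) f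
  with stackSort-∷ʳ (Fill-maxTree d f) (Fill-≢[] f)
... | α , b , eq , α<b
  with max-unique (↭-trans (Perm.∷↭∷ʳ b α) (↭-trans (↭-reflexive (sym eq)) (Fill-stackSort-↭ d f))) α<b V<a
... | refl , α↭V = α , eq , α↭V

vertices≡1⇒leaf : ∀ t → vertices t ≡ 1 → t ≡ leaf
vertices≡1⇒leaf leaf          _  = refl
vertices≡1⇒leaf (onlyLeft l)  eq = contradiction (sym (suc-injective eq)) (<⇒≢ (0<vertices l))
vertices≡1⇒leaf (onlyRight r) eq = contradiction (sym (suc-injective eq)) (<⇒≢ (0<vertices r))
vertices≡1⇒leaf (both _ l r)  eq =
  contradiction (sym (suc-injective eq)) (<⇒≢ (m≤n⇒m≤n+o (vertices r) (0<vertices l)))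

firstLayer-straddle : ∀ {a} l {r} → l ≢ leaf → firstLayer (both (suc a) l r) ≡ firstLayer l
firstLayer-straddle leaf          l≢leaf = contradiction refl l≢leaf
firstLayer-straddle (onlyLeft _)  _      = refl
firstLayer-straddle (onlyRight _) _      = refl
firstLayer-straddle (both _ _ _)  _      = refl

-- `α` is empty exactly when `l` is a leaf, which is the case distinction in `firstLayer`.
run-straddle-firstLayer : ∀ {l r a α D U} → vertices l ≡ suc (length α) →
  All (_< a) α → α ≪ D → All (_< a) D → All (a <_) U → length D ≡ firstLayer r →
  run (α ++ [ a ]) ≡ firstLayer l → run (D ++ U) ≡ firstLayer r →
  run ((α ++ [ a ]) ++ D ++ U) ≡ firstLayer (both (suc zero) l r)
run-straddle-firstLayer {r = r} {D = []} _ _ _ _ _ lD _ _ = contradiction lD (<⇒≢ (0<firstLayer r))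
run-straddle-firstLayer {l} {α = []} {D = _ ∷ D} {U} vl _ _ (d<a ∷ _) _ _ _ runR
  rewrite vertices≡1⇒leaf l vl = trans (run-∷ (D ++ U) d<a) (cong suc runR)
run-straddle-firstLayer {l} {α = _ ∷ _} {D = _ ∷ _} vl α<a α≪D _ a<U _ runL _ =
  trans (run-straddle α<a α≪D a<U (λ ()))
    (trans runL (sym (firstLayer-straddle l λ { refl → contradiction vl λ () })))

-- Both claims need one induction: in the case `straddle`, layeredness at the root requires that `D`
-- hold the values of the first layer of s(R), which only the run length of s(R) guarantees.
Fill-Layered : ∀ {t V p} → Desc V → Fill t V p →
               Layered (stackSort p) × run (stackSort p) ≡ firstLayer t
Fill-Layered _ leaf = [] ∷ [] , refl
Fill-Layered (V<m ∷ dV) F@(onlyLeft {L = L} fl)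
  with L<m , _ ← below {L = L} [] (Fill-↭ F) refl V<m | hL , runL ← Fill-Layered dV fl
  with eq ← ++-identityʳ (stackSort L)
  with h , runp ← Layered-node (Fill-maxTree dV fl) nil L<m []
                    (++-≢[] [] (≢[]-↭ (stackSort-↭ (Fill-maxTree dV fl)) (Fill-≢[] fl)))
                    (subst Layered (sym eq) hL)
  = h , trans runp (trans (cong run eq) runL)
Fill-Layered (W<m ∷ dW) F@(onlyRight {R = R} fr)
  with _ , R<m ← below {L = []} R (Fill-↭ F) refl W<m | hR , runR ← Fill-Layered dW fr
  with h , runp ← Layered-node nil (Fill-maxTree dW fr) [] R<m
                    (≢[]-↭ (stackSort-↭ (Fill-maxTree dW fr)) (Fill-≢[] fr)) hR
  = h , trans runp runR
Fill-Layered (X<m ∷ dX) F@(apart {W = W} {L} {R} fl fr)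
  with below {L = L} R (Fill-↭ F) refl X<m | AllPairs-++⁻ W dX
... | L<m , R<m | dW , dV , W>V =
  proj₁ node′ , trans (proj₂ node′) (trans (run-++ sL≢[] sL≪sR) (proj₂ (Fill-Layered dV fl)))
  where
  sL≢[] : stackSort L ≢ []
  sL≢[] = ≢[]-↭ (stackSort-↭ (Fill-maxTree dV fl)) (Fill-≢[] fl)
  sL≪sR : stackSort L ≪ stackSort R
  sL≪sR x∈ y∈ = W>V (Perm.∈-resp-↭ (Fill-stackSort-↭ dW fr) y∈)
                    (Perm.∈-resp-↭ (Fill-stackSort-↭ dV fl) x∈)
  node′ = Layered-node (Fill-maxTree dV fl) (Fill-maxTree dW fr) L<m R<m (++-≢[] _ sL≢[])
    (Layered-++⁺ sL≪sR (proj₁ (Fill-Layered dV fl)) (proj₁ (Fill-Layered dW fr)))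
Fill-Layered (X<m ∷ dX) F@(straddle {l} {r} {m} {a} {V} {U} {D} {L} {R} fl fr lD)
  with below {L = L} R (Fill-↭ F) refl X<m | Desc-straddle⁻ U D dX
... | L<m , R<m | dW , dV , D<a , a<U , V≪D
  with Fill-Layered dV fl | Fill-Layered dW fr | Fill-stackSort-∷ʳ dV fl | Fill-stackSort-↭ dW fr
-- The first layer `D′` consists of the smallest values of s(R), and it is as long as `D`; so it
-- rearranges `D`, and `U′` rearranges `U`.
... | hL , runL | hR , runR | α , sL≡ , α↭V | sR↭
  with run-firstLayer hR (Unique-resp-↭ (↭-sym sR↭) (Desc⇒Unique dW))
... | D′ , U′ , sR≡ , dD′ , D′≪U′ , lD′
  with Desc-split (U ++ D) U′ D′ dW
         (↭-trans (↭-sym sR↭) (↭-trans (↭-reflexive sR≡) (Perm.++-comm D′ U′))) D′≪U′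
... | A , B , UD≡ , A↭ , B↭
  with ++-injective-suffix {U} {D} {A} {B}
         (trans lD (trans (sym (trans lD′ runR)) (sym (Perm.↭-length B↭)))) UD≡
... | refl , refl =
  proj₁ node′ , trans (proj₂ node′) (trans (cong run w≡)
    (run-straddle-firstLayer {l} {r} |α| α<a α≪D′ D′<a a<U′ (trans lD′ runR)
      (trans (cong run (sym sL≡)) runL) (trans (cong run (sym sR≡)) runR)))
  where
  |α| : vertices l ≡ suc (length α)
  |α| = trans (sym (Fill-length fl)) (cong suc (sym (Perm.↭-length α↭V)))
  α<a : All (_< a) α
  α<a = All-resp-↭ (↭-sym α↭V) (AllPairs.head dV)
  α≪D′ : α ≪ D′
  α≪D′ x∈ y∈ = V≪D (Perm.∈-resp-↭ α↭V x∈) (Perm.∈-resp-↭ (↭-sym B↭) y∈)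
  D′<a : All (_< a) D′
  D′<a = All-resp-↭ B↭ D<a
  a<U′ : All (a <_) U′
  a<U′ = All-resp-↭ A↭ a<U
  w≡ : stackSort L ++ stackSort R ≡ (α ++ [ a ]) ++ D′ ++ U′
  w≡ = cong₂ _++_ sL≡ sR≡
  node′ = Layered-node (Fill-maxTree dV fl) (Fill-maxTree dW fr) L<m R<m
    (++-≢[] _ (≢[]-↭ (stackSort-↭ (Fill-maxTree dV fl)) (Fill-≢[] fl)))
    (subst Layered (sym w≡) (Layered-straddle α<a α≪D′ dD′ D′<a a<U′
      (subst Layered sL≡ hL) (subst Layered sR≡ hR)))

stackSort-Layered⁻ : ∀ {m L R} → All (_< m) L → All (_< m) R → Layered (stackSort (L ++ m ∷ R)) →
                     Layered (stackSort L ++ stackSort R)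
stackSort-Layered⁻ {m} {L} {R} L<m R<m h = proj₁ (Layered-++⁻ (stackSort L ++ stackSort R)
  (subst Layered (trans (stackSort-node L m R L<m R<m)
    (sym (++-assoc (stackSort L) (stackSort R) [ m ]))) h))

-- In the case straddle, a shares its layer in w₁ w₂ with d ∷ D.
data Cut (w₁ w₂ : List ℕ) : Set where
  apart    : w₁ ≪ w₂ → Cut w₁ w₂
  straddle : ∀ {α a d D U} → w₁ ≡ α ++ [ a ] → w₂ ≡ (d ∷ D) ++ U → Desc (d ∷ D) →
          All (_< a) α → α ≪ d ∷ D → All (_< a) (d ∷ D) → All (a <_) U → Cut w₁ w₂

Layered-cut : ∀ {α a} w₂ → All (_< a) α → Layered ((α ++ [ a ]) ++ w₂) →
              Unique ((α ++ [ a ]) ++ w₂) → Cut (α ++ [ a ]) w₂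
Layered-cut {α} {a} w₂ α<a h u
  with subst Layered (++-assoc α [ a ] w₂) h | AllPairs-++⁻ α (subst Unique (++-assoc α [ a ] w₂) u)
... | h′ | _ , a≢ ∷ _ , α≢ with proj₂ (Layered-++⁻ α h′)
... | p ∷ _ with Between⇒split w₂ p a≢
...   | [] , U , refl , _ , _ , a<U = apart λ x∈ y∈ → ≤-<-trans (≤a x∈) (All.lookup a<U y∈)
  where
  ≤a : ∀ {x} → x ∈ α ++ [ a ] → x ≤ a
  ≤a x∈ with ∈-++⁻ α x∈
  ... | inj₁ x∈α         = <⇒≤ (All.lookup α<a x∈α)
  ... | inj₂ (here refl) = ≤-refl
...   | D@(_ ∷ _) , U , refl , dD , D<a , a<U = straddle refl refl dD α<a α≪D D<a a<U
  where
  α≪D : α ≪ D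
  α≪D {x} {y} x∈ y∈ with <-cmp x y
  ... | tri< x<y _ _ = x<y
  -- Equality contradicts distinctness; `y < x` would force `a < x` by layeredness of `x a y`,
  -- although `a` exceeds all of `α`.
  ... | tri≈ _ x≡y _ = contradiction x≡y (α≢ x∈ (there (∈-++⁺ˡ y∈)))
  ... | tri> _ _ y<x = contradiction (proj₂ (Layered⇒Between α h′ x∈ (∈-++⁺ˡ y∈) y<x))
                                     (<-asym (All.lookup α<a x∈))

[]⊎≢[] : ∀ (L : List ℕ) → L ≡ [] ⊎ L ≢ []
[]⊎≢[] []      = inj₁ refl
[]⊎≢[] (_ ∷ _) = inj₂ λ ()

-- The shape of the tree comes from the maxima, the label from the cut between s(L) and s(R). The
-- cut is then transferred to `V`, which supplies the value lists of the two subtrees.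
Fill-surjective : ∀ {p V} → MaxTree p → p ≢ [] → Desc V → p ↭ V → Layered (stackSort p) →
                  ∃[ t ] Fill t V p
Fill-surjective nil p≢[] _ _ _ = contradiction refl p≢[]
Fill-surjective {V = []} _ p≢[] _ p↭V _ = contradiction (Perm.↭-empty-inv p↭V) p≢[]
Fill-surjective {V = v ∷ V} (node {L} {m} {R} l r L<m R<m) _ (V<v ∷ dV) p↭V h
  with max-unique (↭-trans (↭-sym (Perm.shift m L R)) p↭V) (All.++⁺ L<m R<m) V<v
     | stackSort-Layered⁻ L<m R<m h | []⊎≢[] L | []⊎≢[] R
... | refl , LR↭ | _ | inj₁ refl | inj₁ refl with refl ← Perm.↭-empty-inv (↭-sym LR↭) = leaf , leaf
... | refl , LR↭ | hR | inj₁ refl | inj₂ R≢[]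
  with t , f ← Fill-surjective r R≢[] dV LR↭ hR = onlyRight t , onlyRight f
... | refl , LR↭ | hL | inj₂ L≢[] | inj₁ refl
  with t , f ← Fill-surjective l L≢[] dV (↭-trans (↭-reflexive (sym (++-identityʳ L))) LR↭)
                 (proj₁ (Layered-++⁻ (stackSort L) hL)) = onlyLeft t , onlyLeft f
... | refl , LR↭ | hLR | inj₂ L≢[] | inj₂ R≢[]
  with stackSort-∷ʳ l L≢[] | Layered-++⁻ (stackSort L) hLR
     | ↭-trans (Perm.++⁺ (stackSort-↭ l) (stackSort-↭ r)) LR↭
... | α , a , sL≡ , α<a | hL , hR | sLR↭
  with subst (λ w → Cut w (stackSort R)) (sym sL≡)
         (Layered-cut (stackSort R) α<a (subst (λ w → Layered (w ++ stackSort R)) sL≡ hLR)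
           (subst (λ w → Unique (w ++ stackSort R)) sL≡ (Unique-resp-↭ (↭-sym sLR↭) (Desc⇒Unique dV))))
... | apart sL≪sR
  with W , V′ , refl , W↭ , V′↭ ← Desc-split V R L dV (↭-trans (↭-sym LR↭) (Perm.++-comm L R))
         (λ x∈ y∈ → sL≪sR (Perm.∈-resp-↭ (↭-sym (stackSort-↭ l)) x∈) (Perm.∈-resp-↭ (↭-sym (stackSort-↭ r)) y∈))
  with dW , dV′ , _ ← AllPairs-++⁻ W dV
  with t , f ← Fill-surjective l L≢[] dV′ (↭-sym V′↭) hL
     | u , g ← Fill-surjective r R≢[] dW (↭-sym W↭) hR
  = both zero t u , apart f g
... | straddle {β} {b} {d} {D} {U} sL≡′ sR≡ dD β<b β≪D D<b b<U
  -- Three successive cuts bring `V` into the form required by `straddle`: below `U`, below `b`, and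
  -- below `d ∷ D`.
  with Desc-split V U (b ∷ (d ∷ D) ++ β) dV V↭ low≪U
  where
  open PermutationReasoning
  V↭ : V ↭ U ++ b ∷ (d ∷ D) ++ β
  V↭ = begin
    V                              ↭⟨ sLR↭ ⟨
    stackSort L ++ stackSort R     ≡⟨ cong₂ _++_ sL≡′ sR≡ ⟩
    (β ++ [ b ]) ++ (d ∷ D) ++ U   ↭⟨ Perm.++⁺ (↭-sym (Perm.∷↭∷ʳ b β)) (Perm.++-comm (d ∷ D) U) ⟩
    (b ∷ β) ++ U ++ d ∷ D          ↭⟨ Perm.++-comm (b ∷ β) (U ++ d ∷ D) ⟩
    (U ++ d ∷ D) ++ b ∷ β          ≡⟨ ++-assoc U (d ∷ D) (b ∷ β) ⟩
    U ++ (d ∷ D) ++ b ∷ β          ↭⟨ Perm.++⁺ˡ U (Perm.shift b (d ∷ D) β) ⟩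
    U ++ b ∷ (d ∷ D) ++ β          ∎
  ≤b : ∀ {x} → x ∈ b ∷ (d ∷ D) ++ β → x ≤ b
  ≤b (here refl) = ≤-refl
  ≤b (there x∈)  = <⇒≤ (All.lookup (All.++⁺ D<b β<b) x∈)
  low≪U : b ∷ (d ∷ D) ++ β ≪ U
  low≪U x∈ y∈ = ≤-<-trans (≤b x∈) (All.lookup b<U y∈)
... | U′ , X , refl , U′↭ , X↭ with AllPairs-++⁻ U′ dV
... | _ , dX , _ with Desc-split X [ b ] ((d ∷ D) ++ β) dX X↭
                        (λ { x∈ (here refl) → All.lookup (All.++⁺ D<b β<b) x∈ })
... | B , Y , refl , B↭ , Y↭ with refl ← Perm.↭-singleton-inv B↭
  with Desc-split Y (d ∷ D) β (AllPairs.tail dX) Y↭ β≪D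
... | D′ , V′ , refl , D′↭ , V′↭ with Desc-straddle⁻ U′ D′ dV
... | dUD , dbV , _ = both (suc zero) (proj₁ left) (proj₁ right) , straddle (proj₂ left) (proj₂ right) |D′|
  where
  open PermutationReasoning
  L↭ : L ↭ b ∷ V′
  L↭ = begin
    L             ↭⟨ stackSort-↭ l ⟨
    stackSort L   ≡⟨ sL≡′ ⟩
    β ++ [ b ]    ↭⟨ Perm.∷↭∷ʳ b β ⟨
    b ∷ β         ↭⟨ ↭-prep b V′↭ ⟨
    b ∷ V′        ∎
  R↭ : R ↭ U′ ++ D′
  R↭ = begin
    R              ↭⟨ stackSort-↭ r ⟨
    stackSort R    ≡⟨ sR≡ ⟩
    (d ∷ D) ++ U   ↭⟨ Perm.++-comm (d ∷ D) U ⟩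
    U ++ d ∷ D     ↭⟨ Perm.++⁺ U′↭ D′↭ ⟨
    U′ ++ D′       ∎
  left : ∃[ t ] Fill t (b ∷ V′) L
  left = Fill-surjective l L≢[] dbV L↭ hL
  right : ∃[ t ] Fill t (U′ ++ D′) R
  right = Fill-surjective r R≢[] dUD R↭ hR
  D≪U : d ∷ D ≪ U
  D≪U x∈ y∈ = <-trans (All.lookup D<b x∈) (All.lookup b<U y∈)
  -- `d ∷ D` is the first layer of s(R), and its length is read off the right tree just constructed.
  |D′| : length D′ ≡ firstLayer (proj₁ right)
  |D′| = trans (Perm.↭-length D′↭) (trans (sym (run-Desc dD)) (trans (sym (run-++ (λ ()) D≪U))
    (trans (cong run (sym sR≡)) (proj₂ (Fill-Layered dUD (proj₂ right))))))

-- Pattern avoidance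

AllPairs-lookup : ∀ {R : ℕ → ℕ → Set} {w} → AllPairs R w →
                  ∀ {i j} → i Fin.< j → R (lookup w i) (lookup w j)
AllPairs-lookup (p ∷ _) {zero}  {suc j} _         = All.lookup p (∈-lookup j)
AllPairs-lookup (_ ∷ h) {suc i} {suc j} (s≤s i<j) = AllPairs-lookup h i<j

Layered-lookup : ∀ {w} → Layered w → ∀ {i j k} → i Fin.< j → j Fin.< k →
                 Between (lookup w i) (lookup w j) (lookup w k)
Layered-lookup (p ∷ _) {zero}  {suc j} {suc k} _         (s≤s j<k) = AllPairs-lookup p j<k
Layered-lookup (_ ∷ h) {suc i} {suc j} {suc k} (s≤s i<j) (s≤s j<k) = Layered-lookup h i<j j<k

lookup⇒Layered : ∀ w → (∀ {i j k} → i Fin.< j → j Fin.< k →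
                 Between (lookup w i) (lookup w j) (lookup w k)) → Layered w
lookup⇒Layered []      _ = []
lookup⇒Layered (x ∷ w) h =
  subst (AllPairs (Between x)) (tabulate-lookup w)
    (AllPairs.tabulate⁺-< λ j<k → h {zero} (s≤s z≤n) (s≤s j<k))
  ∷ lookup⇒Layered w λ i<j j<k → h (s≤s i<j) (s≤s j<k)

231-pattern 312-pattern : List ℕ
231-pattern = 2 ∷ 3 ∷ 1 ∷ []
312-pattern = 3 ∷ 1 ∷ 2 ∷ []

Layered⇒Avoids231 : ∀ {w} → Layered w → Avoids w 231-pattern
Layered⇒Avoids231 h (f , mono , iso) =
  <-asym (Equivalence.from (iso zero (suc zero)) (from-yes (2 <? 3)))
         (proj₂ (Layered-lookup h (mono zero (suc zero) (s≤s z≤n)) (mono (suc zero) (suc (suc zero)) (s≤s (s≤s z≤n)))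
           (Equivalence.from (iso (suc (suc zero)) zero) (from-yes (1 <? 2)))))

Layered⇒Avoids312 : ∀ {w} → Layered w → Avoids w 312-pattern
Layered⇒Avoids312 h (f , mono , iso) =
  <-asym (Equivalence.from (iso (suc zero) (suc (suc zero))) (from-yes (1 <? 2)))
         (proj₁ (Layered-lookup h (mono zero (suc zero) (s≤s z≤n)) (mono (suc zero) (suc (suc zero)) (s≤s (s≤s z≤n)))
           (Equivalence.from (iso (suc (suc zero)) zero) (from-yes (2 <? 3)))))

triple : ∀ {A : Set} → A → A → A → Fin 3 → A
triple i j k zero             = i
triple i j k (suc zero)       = j
triple i j k (suc (suc zero)) = k

triple-mono : ∀ {n} {i j k : Fin n} → i Fin.< j → j Fin.< k →
              ∀ a b → a Fin.< b → triple i j k a Fin.< triple i j k b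
triple-mono i<j j<k zero       (suc zero)       _ = i<j
triple-mono i<j j<k zero       (suc (suc zero)) _ = <-trans i<j j<k
triple-mono i<j j<k (suc zero) (suc (suc zero)) _ = j<k
triple-mono i<j j<k (suc zero)       (suc zero)       (s≤s ())
triple-mono i<j j<k (suc (suc zero)) (suc zero)       (s≤s ())
triple-mono i<j j<k (suc (suc zero)) (suc (suc zero)) (s≤s (s≤s ()))

both-hold : ∀ {P Q : Set} → P → Q → P ⇔ Q
both-hold p q = mk⇔ (λ _ → q) (λ _ → p)

both-fail : ∀ {P Q : Set} → ¬ P → ¬ Q → P ⇔ Q
both-fail ¬p ¬q = mk⇔ (⊥-elim ∘ ¬p) (⊥-elim ∘ ¬q)

contains231 : ∀ {w i j k} → i Fin.< j → j Fin.< k →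
              lookup w k < lookup w i → lookup w i < lookup w j → Contains w 231-pattern
contains231 {w} {i} {j} {k} i<j j<k k<i i<′j = triple i j k , triple-mono i<j j<k , λ
  { zero zero                         → both-fail (<-irrefl refl) (from-no (2 <? 2))
  ; zero (suc zero)                   → both-hold i<′j (from-yes (2 <? 3))
  ; zero (suc (suc zero))             → both-fail (<-asym k<i) (from-no (2 <? 1))
  ; (suc zero) zero                   → both-fail (<-asym i<′j) (from-no (3 <? 2))
  ; (suc zero) (suc zero)             → both-fail (<-irrefl refl) (from-no (3 <? 3))
  ; (suc zero) (suc (suc zero))       → both-fail (<-asym (<-trans k<i i<′j)) (from-no (3 <? 1))
  ; (suc (suc zero)) zero             → both-hold k<i (from-yes (1 <? 2))
  ; (suc (suc zero)) (suc zero)       → both-hold (<-trans k<i i<′j) (from-yes (1 <? 3))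
  ; (suc (suc zero)) (suc (suc zero)) → both-fail (<-irrefl refl) (from-no (1 <? 1)) }

contains312 : ∀ {w i j k} → i Fin.< j → j Fin.< k →
              lookup w j < lookup w k → lookup w k < lookup w i → Contains w 312-pattern
contains312 {w} {i} {j} {k} i<j j<k j<′k k<i = triple i j k , triple-mono i<j j<k , λ
  { zero zero                         → both-fail (<-irrefl refl) (from-no (3 <? 3))
  ; zero (suc zero)                   → both-fail (<-asym (<-trans j<′k k<i)) (from-no (3 <? 1))
  ; zero (suc (suc zero))             → both-fail (<-asym k<i) (from-no (3 <? 2))
  ; (suc zero) zero                   → both-hold (<-trans j<′k k<i) (from-yes (1 <? 3))
  ; (suc zero) (suc zero)             → both-fail (<-irrefl refl) (from-no (1 <? 1))
  ; (suc zero) (suc (suc zero))       → both-hold j<′k (from-yes (1 <? 2))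
  ; (suc (suc zero)) zero             → both-hold k<i (from-yes (2 <? 3))
  ; (suc (suc zero)) (suc zero)       → both-fail (<-asym j<′k) (from-no (2 <? 1))
  ; (suc (suc zero)) (suc (suc zero)) → both-fail (<-irrefl refl) (from-no (2 <? 2)) }

-- Each inequality of `Between` holds weakly because its failure would be a forbidden pattern, and
-- strictly because the entries are distinct.
Avoids⇒Layered : ∀ {w} → Unique w → Avoids w 231-pattern → Avoids w 312-pattern → Layered w
Avoids⇒Layered {w} u ¬231 ¬312 = lookup⇒Layered w λ {i} {j} {k} i<j j<k k<i →
  ≤∧≢⇒< (≮⇒≥ (λ j<′k → ¬312 (contains312 {w} i<j j<k j<′k k<i))) (AllPairs-lookup u j<k ∘ sym) ,
  ≤∧≢⇒< (≮⇒≥ (λ i<′j → ¬231 (contains231 {w} i<j j<k k<i i<′j))) (AllPairs-lookup u i<j ∘ sym)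

-- The bijection

downFromTo1 : ℕ → List ℕ
downFromTo1 = applyDownFrom suc

Desc-downFromTo1 : ∀ n → Desc (downFromTo1 n)
Desc-downFromTo1 n = AllPairs.applyDownFrom⁺₁ suc n (λ j<i _ → s≤s j<i)

downFromTo1-↭ : ∀ n → downFromTo1 n ↭ applyUpTo suc n
downFromTo1-↭ n = ↭-trans (↭-reflexive (sym (reverse-applyUpTo suc n))) (Perm.↭-reverse _)

encode-Fill : ∀ t → ∃[ p ] Fill t (downFromTo1 (vertices t)) p
encode-Fill t = Fill-total t _ (length-applyDownFrom suc (vertices t))

encode : 01-Tree → List ℕ
encode = proj₁ ∘ encode-Fill

encode-injective : ∀ {t u} → encode t ≡ encode u → t ≡ u
encode-injective {t} {u} eq = begin
  t                     ≡⟨ Fill-decode (m≤m+n _ (vertices u)) (Desc-downFromTo1 _) (proj₂ (encode-Fill t)) ⟨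
  decode f (encode t)   ≡⟨ cong (decode f) eq ⟩
  decode f (encode u)   ≡⟨ Fill-decode (m≤n+m _ (vertices t)) (Desc-downFromTo1 _) (proj₂ (encode-Fill u)) ⟩
  u                     ∎
  where
  open ≡-Reasoning
  -- A common depth bound for two trees whose sizes are not yet known to agree.
  f : ℕ
  f = vertices t + vertices u

proposition2p1 : (n k : ℕ) → 1 ≤ n → 1 ≤ k →
    HasCardinality
    (λ p → stackSort⁻¹ n (Av n (2 ∷ 3 ∷ 1 ∷ []) (3 ∷ 1 ∷ 2 ∷ [])) p × descents p ≡ k ∸ 1)
    (BoNa n k)
proposition2p1 n k 1≤n _ with BoNa-counts n k
... | ts , unique , member , size =
  map encode ts , Unique.map⁺ encode-injective unique , (λ p → mk⇔ to from) ,
  trans (length-map encode ts) size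
  where
  Image : List ℕ → Set
  Image p = stackSort⁻¹ n (Av n 231-pattern 312-pattern) p × descents p ≡ k ∸ 1

  to : ∀ {p} → p ∈ map encode ts → Image p
  to p∈ with ∈-map⁻ encode p∈
  ... | t , t∈ , refl with Equivalence.to (member t) t∈
  -- Matching on `refl` makes `n` the number of vertices of `t`, so `encode t` uses exactly the
  -- values 1, ..., n.
  ... | refl , edges with encode-Fill t
  ... | p , f = (perm , ↭-trans (stackSort-↭ (Fill-maxTree d f)) perm ,
      Layered⇒Avoids231 layered , Layered⇒Avoids312 layered) , trans (Fill-descents d f) edges
    where
    d : Desc (downFromTo1 (vertices t))
    d = Desc-downFromTo1 _
    perm : p ↭ applyUpTo suc (vertices t)
    perm = ↭-trans (Fill-↭ f) (downFromTo1-↭ _)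
    layered : Layered (stackSort p)
    layered = proj₁ (Fill-Layered d f)

  from : ∀ {p} → Image p → p ∈ map encode ts
  from {p} ((perm , sperm , ¬231 , ¬312) , des)
    with Fill-surjective (maxTree unique-p) p≢[] d p↭ layered
    where
    d : Desc (downFromTo1 n)
    d = Desc-downFromTo1 n
    p↭ : p ↭ downFromTo1 n
    p↭ = ↭-trans perm (↭-sym (downFromTo1-↭ n))
    unique-p : Unique p
    unique-p = Unique-resp-↭ (↭-sym p↭) (Desc⇒Unique d)
    -- No tree encodes the empty word; `1 ≤ n` excludes it.
    p≢[] : p ≢ []
    p≢[] refl = contradiction (trans (Perm.↭-length p↭) (length-applyDownFrom suc n)) (<⇒≢ 1≤n)
    layered : Layered (stackSort p)
    layered = Avoids⇒Layered
      (Unique-resp-↭ (↭-trans (downFromTo1-↭ n) (↭-sym sperm)) (Desc⇒Unique d)) ¬231 ¬312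
  ... | t , f = subst (_∈ map encode ts) (sym p≡) (∈-map⁺ encode (Equivalence.from (member t) (vertices≡n , edges)))
    where
    vertices≡n : vertices t ≡ n
    vertices≡n = trans (sym (Fill-length f)) (length-applyDownFrom suc n)
    edges : rightEdges t ≡ k ∸ 1
    edges = trans (sym (Fill-descents (Desc-downFromTo1 n) f)) des
    -- `p` and `encode t` fill the same tree with the same values, hence coincide.
    p≡ : p ≡ encode t
    p≡ = Fill-functional f (proj₂ (encode-Fill t)) (cong downFromTo1 (sym vertices≡n))
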